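{- Let $Q$ be a finite (left) quasifield with $q$ elements and kernel $K$. Let $\gamma\in Q\setminus\{0\}$ and $A,B,C,D\subset Q$. If $N_\gamma(A,B,C,D)$ is the number of solutions to $a\cdot b + c\cdot d = \gamma$ with $(a,b,c,d)\in A\times B\times C\times D$, then \[ \left| N_\gamma(A,B,C,D) - \frac{|A||B||C||D|}{q}\right| \leq q\left(\frac{|A||B||C||D|}{|K|-1}\right)^{1/2}. \]
   Context: A (left) quasifield is a set $Q$ with two binary operations $+$ and $\cdot$ such that $(Q,+)$ is a group with identity $0$; $(Q\setminus\{0\},\cdot)$ is a loop (for all $a,b$ the equations $a\cdot x=b$ and $y\cdot a=b$ have unique solutions, and there is an identity $1$); $a\cdot(b+c)=a\cdot b+a\cdot c$ for all $a,b,c$; $0\cdot x=0$ for all $x$; and for $a\neq b$ the equation $a\cdot x=b\cdot x+c$ has exactly one solution $x$. The kernel $K$ of $Q$ is the set of all $k\in Q$ such that $(x+y)\cdot k = x\cdot k + y\cdot k$ and $(x\cdot y)\cdot k = x\cdot(y\cdot k)$ for all $x,y\in Q$. -}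

module Defs where

open import Data.Nat using (ℕ; zero; suc; _+_)
open import Data.Fin using (Fin; zero; suc)
open import Data.Fin.Subset using (Subset; _∈_)
open import Data.Vec using (lookup)
open import Data.Bool using (Bool; true; false; _∧_; if_then_else_)
open import Data.Product using (Σ; _×_)
open import Data.Fin.Properties using (_≟_)
open import Relation.Nullary using (¬_)
open import Relation.Nullary.Decidable using (⌊_⌋)
open import Relation.Binary.PropositionalEquality using (_≡_)

record Quasifield (q : ℕ) : Set where
  field
    _⊕_ : Fin q → Fin q → Fin q
    _⊙_ : Fin q → Fin q → Fin q
    𝟘 : Fin q
    𝟙 : Fin q
    ⊖_ : Fin q → Fin q
    ⊕-assoc : ∀ x y z → (x ⊕ y) ⊕ z ≡ x ⊕ (y ⊕ z)
    ⊕-identityˡ : ∀ x → 𝟘 ⊕ x ≡ x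
    ⊕-identityʳ : ∀ x → x ⊕ 𝟘 ≡ x
    ⊕-inverseˡ : ∀ x → (⊖ x) ⊕ x ≡ 𝟘
    ⊕-inverseʳ : ∀ x → x ⊕ (⊖ x) ≡ 𝟘
    𝟙≢𝟘 : ¬ (𝟙 ≡ 𝟘)
    ⊙-closed : ∀ a b → ¬ (a ≡ 𝟘) → ¬ (b ≡ 𝟘) → ¬ ((a ⊙ b) ≡ 𝟘)
    ⊙-identityˡ : ∀ x → ¬ (x ≡ 𝟘) → 𝟙 ⊙ x ≡ x
    ⊙-identityʳ : ∀ x → ¬ (x ≡ 𝟘) → x ⊙ 𝟙 ≡ x
    left-div : ∀ a b → ¬ (a ≡ 𝟘) → ¬ (b ≡ 𝟘) →
      Σ (Fin q) λ x → ¬ (x ≡ 𝟘) × (a ⊙ x ≡ b)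
    left-div-unique : ∀ a x y → ¬ (a ≡ 𝟘) → ¬ (x ≡ 𝟘) → ¬ (y ≡ 𝟘) →
      a ⊙ x ≡ a ⊙ y → x ≡ y
    right-div : ∀ a b → ¬ (a ≡ 𝟘) → ¬ (b ≡ 𝟘) →
      Σ (Fin q) λ y → ¬ (y ≡ 𝟘) × (y ⊙ a ≡ b)
    right-div-unique : ∀ a x y → ¬ (a ≡ 𝟘) → ¬ (x ≡ 𝟘) → ¬ (y ≡ 𝟘) →
      x ⊙ a ≡ y ⊙ a → x ≡ y
    distribˡ : ∀ a b c → a ⊙ (b ⊕ c) ≡ (a ⊙ b) ⊕ (a ⊙ c)
    zeroˡ : ∀ x → 𝟘 ⊙ x ≡ 𝟘
    planar : ∀ a b c → ¬ (a ≡ b) → Σ (Fin q) λ x → a ⊙ x ≡ (b ⊙ x) ⊕ c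
    planar-unique : ∀ a b c x y → ¬ (a ≡ b) →
      a ⊙ x ≡ (b ⊙ x) ⊕ c → a ⊙ y ≡ (b ⊙ y) ⊕ c → x ≡ y

  InKernel : Fin q → Set
  InKernel k = (∀ x y → (x ⊕ y) ⊙ k ≡ (x ⊙ k) ⊕ (y ⊙ k))
             × (∀ x y → (x ⊙ y) ⊙ k ≡ x ⊙ (y ⊙ k))

sumFin : {n : ℕ} → (Fin n → ℕ) → ℕ
sumFin {zero} f = 0
sumFin {suc n} f = f zero + sumFin (λ i → f (suc i))

module _ {q : ℕ} (Q : Quasifield q) where
  open Quasifield Q

  Nγ : Fin q → Subset q → Subset q → Subset q → Subset q → ℕ
  Nγ γ A B C D =
    sumFin λ a → sumFin λ b → sumFin λ c → sumFin λ d →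
      if lookup A a ∧ lookup B b ∧ lookup C c ∧ lookup D d
           ∧ ⌊ ((a ⊙ b) ⊕ (c ⊙ d)) ≟ γ ⌋
      then 1 else 0

-- For x = (a , c) and y = (b , d) put x · y = ab + cd and φ x (y , g) = q [x · y = g] - 1.
-- Planarity makes the φ x pairwise orthogonal: for x ≠ x′ exactly q of the y satisfy
-- x · y = x′ · y.  Hence T = ∑_{x ∈ A × C} φ x has second moment at most q⁴ |A| |C|.
-- Scaling (y , g) ↦ (yk , gk) by a nonzero k in the kernel preserves T, so the slices
-- S (γk) = ∑_y T(y , γk)² all equal S γ, whence (|K| - 1) S γ ≤ q⁴ |A| |C|.  Finally
-- qN - X = ∑_{y ∈ B × D} T(y , γ), to which Cauchy–Schwarz applies.

{-# OPTIONS --safe #-}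
module Submission where

open import Defs
open import Algebra.Bundles using (Group)
import Algebra.Properties.Group as GroupProperties
open import Data.Bool using (Bool; true; false; _∧_; if_then_else_)
open import Data.Empty using (⊥-elim)
open import Data.Fin using (Fin; zero; suc)
open import Data.Fin.Properties using (_≟_)
open import Data.Fin.Subset using (Subset; _∈_; ∣_∣)
open import Data.Fin.Subset.Properties using (x∈p⇒∣p-x∣<∣p∣)
open import Data.Integer
  using (ℤ; +_; -[1+_]; _+_; _-_; _≤_; 0ℤ; 1ℤ; NonNegative; nonNegative; +≤+)
import Data.Integer.Properties as ℤ
open import Data.Integer.Tactic.RingSolver using (solve-∀)
open import Data.List using (List; []; _∷_; _++_; map; cartesianProduct; allFin; tabulate)
import Data.Nat as ℕ
open import Data.Nat using (ℕ; z≤n; s≤s)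
import Data.Nat.Properties as ℕ
open import Data.Product using (Σ; _×_; _,_; proj₁; proj₂)
open import Data.Product.Properties using (≡-dec)
open import Data.Vec using ([]; _∷_; lookup)
open import Data.Vec.Properties using ([]=⇒lookup; lookup⇒[]=)
open import Function using (_∘_; id)
open import Function.Bundles using (_⇔_; Equivalence)
open import Relation.Binary.Definitions using (DecidableEquality)
open import Relation.Binary.PropositionalEquality
  using (_≡_; _≢_; refl; sym; trans; cong; cong₂; subst; subst₂; isEquivalence; module ≡-Reasoning)
open import Relation.Nullary using (¬_; Dec; yes; no)
open import Relation.Nullary.Decidable using (⌊_⌋)

-- Finite sums of integers over lists.

module _ where
  open import Data.Integer using (_*_)

  *-congˡ : ∀ i {j k : ℤ} → j ≡ k → i * j ≡ i * k
  *-congˡ i = cong (i *_)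

  +-congˡ : ∀ i {j k : ℤ} → j ≡ k → i + j ≡ i + k
  +-congˡ i = cong (λ j → i + j)

  0≤i*i : ∀ i → 0ℤ ≤ i * i
  0≤i*i (+ n) = subst (0ℤ ≤_) (ℤ.pos-* n n) (+≤+ z≤n)
  0≤i*i (-[1+ n ]) = +≤+ z≤n

  ∑ : {I : Set} → List I → (I → ℤ) → ℤ
  ∑ []       f = 0ℤ
  ∑ (x ∷ xs) f = f x + ∑ xs f

  module _ {I : Set} where

    ∑-cong : ∀ xs {f g : I → ℤ} → (∀ x → f x ≡ g x) → ∑ xs f ≡ ∑ xs g
    ∑-cong []       f≗g = refl
    ∑-cong (x ∷ xs) f≗g = cong₂ _+_ (f≗g x) (∑-cong xs f≗g)

    ∑-mono : ∀ xs {f g : I → ℤ} → (∀ x → f x ≤ g x) → ∑ xs f ≤ ∑ xs g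
    ∑-mono []       f≤g = ℤ.≤-refl
    ∑-mono (x ∷ xs) f≤g = ℤ.+-mono-≤ (f≤g x) (∑-mono xs f≤g)

    ∑-zero : ∀ (xs : List I) → ∑ xs (λ _ → 0ℤ) ≡ 0ℤ
    ∑-zero []       = refl
    ∑-zero (x ∷ xs) = trans (ℤ.+-identityˡ _) (∑-zero xs)

    ∑-nonneg : ∀ xs {f : I → ℤ} → (∀ x → 0ℤ ≤ f x) → 0ℤ ≤ ∑ xs f
    ∑-nonneg xs 0≤f = subst (λ z → z ≤ ∑ xs _) (∑-zero xs) (∑-mono xs 0≤f)

    ∑-+ : ∀ xs (f g : I → ℤ) → ∑ xs (λ x → f x + g x) ≡ ∑ xs f + ∑ xs g
    ∑-+ []       f g = refl
    ∑-+ (x ∷ xs) f g rewrite ∑-+ xs f g = swap₄ (f x) (g x) (∑ xs f) (∑ xs g)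
      where
      swap₄ : ∀ a b c d → (a + b) + (c + d) ≡ (a + c) + (b + d)
      swap₄ = solve-∀

    ∑-*ˡ : ∀ xs k (f : I → ℤ) → ∑ xs (λ x → k * f x) ≡ k * ∑ xs f
    ∑-*ˡ []       k f = sym (ℤ.*-zeroʳ k)
    ∑-*ˡ (x ∷ xs) k f rewrite ∑-*ˡ xs k f = sym (ℤ.*-distribˡ-+ k (f x) (∑ xs f))

    ∑-*ʳ : ∀ xs k (f : I → ℤ) → ∑ xs (λ x → f x * k) ≡ ∑ xs f * k
    ∑-*ʳ xs k f = trans (∑-cong xs λ x → ℤ.*-comm (f x) k)
                        (trans (∑-*ˡ xs k f) (ℤ.*-comm k (∑ xs f)))

    ∑-- : ∀ xs (f g : I → ℤ) → ∑ xs (λ x → f x - g x) ≡ ∑ xs f - ∑ xs g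
    ∑-- []       f g = refl
    ∑-- (x ∷ xs) f g rewrite ∑-- xs f g = swap₄ (f x) (g x) (∑ xs f) (∑ xs g)
      where
      swap₄ : ∀ a b c d → (a - b) + (c - d) ≡ (a + c) - (b + d)
      swap₄ = solve-∀

    ∑-++ : ∀ xs ys (f : I → ℤ) → ∑ (xs ++ ys) f ≡ ∑ xs f + ∑ ys f
    ∑-++ []       ys f = sym (ℤ.+-identityˡ _)
    ∑-++ (x ∷ xs) ys f rewrite ∑-++ xs ys f = sym (ℤ.+-assoc (f x) (∑ xs f) (∑ ys f))

  module _ {I J : Set} where

    ∑-map : ∀ xs (g : I → J) (f : J → ℤ) → ∑ (map g xs) f ≡ ∑ xs (f ∘ g)
    ∑-map []       g f = refl
    ∑-map (x ∷ xs) g f = +-congˡ (f (g x)) (∑-map xs g f)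

  module _ {I J : Set} where

    ∑-comm : ∀ xs ys (f : I → J → ℤ) →
             ∑ xs (λ x → ∑ ys (f x)) ≡ ∑ ys (λ y → ∑ xs (λ x → f x y))
    ∑-comm []       ys f = sym (∑-zero ys)
    ∑-comm (x ∷ xs) ys f = trans (+-congˡ (∑ ys (f x)) (∑-comm xs ys f))
                                 (sym (∑-+ ys (f x) _))

    ∑-cartesianProduct : ∀ xs ys (f : I × J → ℤ) →
      ∑ (cartesianProduct xs ys) f ≡ ∑ xs (λ x → ∑ ys (λ y → f (x , y)))
    ∑-cartesianProduct []       ys f = refl
    ∑-cartesianProduct (x ∷ xs) ys f = trans (∑-++ (map (x ,_) ys) _ f)
      (cong₂ _+_ (∑-map ys (x ,_) f) (∑-cartesianProduct xs ys f))

    ∑*∑ : ∀ xs ys (f : I → ℤ) (g : J → ℤ) →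
          ∑ xs (λ x → ∑ ys (λ y → f x * g y)) ≡ ∑ xs f * ∑ ys g
    ∑*∑ xs ys f g = trans (∑-cong xs λ x → ∑-*ˡ ys (f x) g) (∑-*ʳ xs (∑ ys g) f)

  -- Lagrange's identity: twice the deficit is Σ_x Σ_y (f x g y - f y g x)².
  cauchySchwarz : ∀ {I : Set} xs (f g : I → ℤ) →
    ∑ xs (λ x → f x * g x) * ∑ xs (λ x → f x * g x) ≤
    ∑ xs (λ x → f x * f x) * ∑ xs (λ x → g x * g x)
  cauchySchwarz xs f g = ℤ.*-cancelˡ-≤-pos _ _ (+ 2) (ℤ.0≤i-j⇒j≤i
    (subst (0ℤ ≤_) lagrange (∑-nonneg xs λ x → ∑-nonneg xs λ y →
      0≤i*i (f x * g y - f y * g x))))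
    where
    F = λ x → f x * f x
    G = λ x → g x * g x
    H = λ x → f x * g x
    square : ∀ a b c d → (a * d - b * c) * (a * d - b * c) ≡
             ((a * a) * (d * d) + (c * c) * (b * b)) - + 2 * ((a * c) * (b * d))
    square = solve-∀
    collect : ∀ s t u → (s * t + t * s) - + 2 * (u * u) ≡ + 2 * (s * t) - + 2 * (u * u)
    collect = solve-∀
    lagrange : ∑ xs (λ x → ∑ xs λ y → (f x * g y - f y * g x) * (f x * g y - f y * g x)) ≡
               + 2 * (∑ xs F * ∑ xs G) - + 2 * (∑ xs H * ∑ xs H)
    lagrange = begin
      ∑ xs (λ x → ∑ xs λ y → (f x * g y - f y * g x) * (f x * g y - f y * g x))
        ≡⟨ (∑-cong xs λ x → ∑-cong xs λ y → square (f x) (f y) (g x) (g y)) ⟩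
      ∑ xs (λ x → ∑ xs λ y → (F x * G y + G x * F y) - + 2 * (H x * H y))
        ≡⟨ (∑-cong xs λ x → trans (∑-- xs _ _)
             (cong₂ _-_ (∑-+ xs _ _) (∑-*ˡ xs (+ 2) _))) ⟩
      ∑ xs (λ x → (∑ xs (λ y → F x * G y) + ∑ xs (λ y → G x * F y))
                - + 2 * ∑ xs (λ y → H x * H y))
        ≡⟨ trans (∑-- xs _ _) (cong₂ _-_ (∑-+ xs _ _) (∑-*ˡ xs (+ 2) _)) ⟩
      (∑ xs (λ x → ∑ xs (λ y → F x * G y)) + ∑ xs (λ x → ∑ xs (λ y → G x * F y)))
        - + 2 * ∑ xs (λ x → ∑ xs (λ y → H x * H y))
        ≡⟨ cong₂ _-_ (cong₂ _+_ (∑*∑ xs xs F G) (∑*∑ xs xs G F))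
                     (*-congˡ (+ 2) (∑*∑ xs xs H H)) ⟩
      (∑ xs F * ∑ xs G + ∑ xs G * ∑ xs F) - + 2 * (∑ xs H * ∑ xs H)
        ≡⟨ collect (∑ xs F) (∑ xs G) (∑ xs H) ⟩
      + 2 * (∑ xs F * ∑ xs G) - + 2 * (∑ xs H * ∑ xs H) ∎
      where open ≡-Reasoning

  -- Expanding the square and summing over `v` first exposes the Gram matrix of the family `φ`, so
  -- orthogonality of the family can be applied entry by entry.
  ∑-square : ∀ {I J : Set} xs vs (w : I → ℤ) (φ : I → J → ℤ) →
    ∑ vs (λ v → ∑ xs (λ x → w x * φ x v) * ∑ xs (λ x → w x * φ x v)) ≡
    ∑ xs (λ x → w x * ∑ xs (λ y → w y * ∑ vs (λ v → φ x v * φ y v)))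
  ∑-square xs vs w φ = begin
    ∑ vs (λ v → ∑ xs (λ x → w x * φ x v) * ∑ xs (λ x → w x * φ x v))
      ≡⟨ (∑-cong vs λ v → ∑*∑ xs xs _ _) ⟨
    ∑ vs (λ v → ∑ xs λ x → ∑ xs λ y → (w x * φ x v) * (w y * φ y v))
      ≡⟨ ∑-comm vs xs _ ⟩
    ∑ xs (λ x → ∑ vs λ v → ∑ xs λ y → (w x * φ x v) * (w y * φ y v))
      ≡⟨ (∑-cong xs λ x → ∑-comm vs xs _) ⟩
    ∑ xs (λ x → ∑ xs λ y → ∑ vs λ v → (w x * φ x v) * (w y * φ y v))
      ≡⟨ (∑-cong xs λ x → ∑-cong xs λ y → trans
           (∑-cong vs λ v → regroup (w x) (φ x v) (w y) (φ y v))
           (trans (∑-*ˡ vs (w x) _) (*-congˡ (w x) (∑-*ˡ vs (w y) _)))) ⟩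
    ∑ xs (λ x → ∑ xs λ y → w x * (w y * ∑ vs (λ v → φ x v * φ y v)))
      ≡⟨ (∑-cong xs λ x → ∑-*ˡ xs (w x) _) ⟩
    ∑ xs (λ x → w x * ∑ xs (λ y → w y * ∑ vs (λ v → φ x v * φ y v))) ∎
    where
    open ≡-Reasoning
    regroup : ∀ a b c d → (a * b) * (c * d) ≡ a * (c * (b * d))
    regroup = solve-∀

  -- Indicators and sums over enumerated types.

  ⟦_⟧ : Bool → ℤ
  ⟦ b ⟧ = if b then 1ℤ else 0ℤ

  ⟦⟧-∧ : ∀ a b → ⟦ a ∧ b ⟧ ≡ ⟦ a ⟧ * ⟦ b ⟧
  ⟦⟧-∧ true  b = sym (ℤ.*-identityˡ ⟦ b ⟧)
  ⟦⟧-∧ false b = sym (ℤ.*-zeroˡ ⟦ b ⟧)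

  ⟦⟧-idem : ∀ b → ⟦ b ⟧ * ⟦ b ⟧ ≡ ⟦ b ⟧
  ⟦⟧-idem true  = refl
  ⟦⟧-idem false = refl

  𝟏 : ∀ {P : Set} → Dec P → ℤ
  𝟏 d = ⟦ ⌊ d ⌋ ⟧

  𝟏-true : ∀ {P : Set} (d : Dec P) → P → 𝟏 d ≡ 1ℤ
  𝟏-true (yes _) p = refl
  𝟏-true (no ¬p) p = ⊥-elim (¬p p)

  𝟏-false : ∀ {P : Set} (d : Dec P) → ¬ P → 𝟏 d ≡ 0ℤ
  𝟏-false (yes p) ¬p = ⊥-elim (¬p p)
  𝟏-false (no _)  ¬p = refl

  𝟏-cong : ∀ {P R : Set} (d : Dec P) (e : Dec R) → (P → R) → (R → P) → 𝟏 d ≡ 𝟏 e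
  𝟏-cong (yes p) e to from = sym (𝟏-true e (to p))
  𝟏-cong (no ¬p) e to from = sym (𝟏-false e (¬p ∘ from))

  -- xs lists every element exactly once, phrased so that it rewrites sums directly.
  Enumeration : {I : Set} → List I → Set
  Enumeration {I} xs = ∀ x (h : I → ℤ) → (∀ y → y ≢ x → h y ≡ 0ℤ) → ∑ xs h ≡ h x

  ∑-tabulate : ∀ {n} {I : Set} (g : Fin n → I) (f : I → ℕ) →
               ∑ (tabulate g) (λ i → + f i) ≡ + sumFin (f ∘ g)
  ∑-tabulate {ℕ.zero}  g f = refl
  ∑-tabulate {ℕ.suc n} g f = +-congˡ (+ f (g zero)) (∑-tabulate (g ∘ suc) f)

  -- The tail of `allFin (suc n)` is `tabulate suc`, not a list of the form `allFin n`. This lemma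
  -- restores that form, so that inductions on `n` close.
  ∑-tabulate-∘ : ∀ {n} {I : Set} (g : Fin n → I) (f : I → ℤ) →
                 ∑ (tabulate g) f ≡ ∑ (allFin n) (f ∘ g)
  ∑-tabulate-∘ {ℕ.zero}  g f = refl
  ∑-tabulate-∘ {ℕ.suc n} g f = +-congˡ (f (g zero))
    (trans (∑-tabulate-∘ (g ∘ suc) f) (sym (∑-tabulate-∘ suc (f ∘ g))))

  ∑-one : ∀ n → ∑ (allFin n) (λ _ → 1ℤ) ≡ + n
  ∑-one ℕ.zero    = refl
  ∑-one (ℕ.suc n) = +-congˡ 1ℤ (trans (∑-tabulate-∘ {n} suc (λ _ → 1ℤ)) (∑-one n))

  ∑-const : ∀ n k → ∑ (allFin n) (λ _ → k) ≡ + n * k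
  ∑-const n k = trans (∑-cong (allFin n) λ _ → sym (ℤ.*-identityˡ k))
    (trans (∑-*ʳ (allFin n) k (λ _ → 1ℤ)) (cong (_* k) (∑-one n)))

  allFin-enumeration : ∀ n → Enumeration (allFin n)
  allFin-enumeration (ℕ.suc n) zero h h≡0 =
    trans (+-congˡ (h zero) (begin
      ∑ (tabulate suc) h        ≡⟨ ∑-tabulate-∘ suc h ⟩
      ∑ (allFin n) (h ∘ suc)    ≡⟨ (∑-cong (allFin n) λ i → h≡0 (suc i) λ ()) ⟩
      ∑ (allFin n) (λ _ → 0ℤ)   ≡⟨ ∑-zero (allFin n) ⟩
      0ℤ                        ∎)) (ℤ.+-identityʳ (h zero))
    where open ≡-Reasoning
  allFin-enumeration (ℕ.suc n) (suc x) h h≡0 = begin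
    h zero + ∑ (tabulate suc) h
      ≡⟨ cong₂ _+_ (h≡0 zero λ ()) (∑-tabulate-∘ suc h) ⟩
    0ℤ + ∑ (allFin n) (h ∘ suc)
      ≡⟨ ℤ.+-identityˡ _ ⟩
    ∑ (allFin n) (h ∘ suc)
      ≡⟨ allFin-enumeration n x (h ∘ suc) (λ y y≢x → h≡0 (suc y) λ { refl → y≢x refl }) ⟩
    h (suc x) ∎
    where open ≡-Reasoning

  cartesianProduct-enumeration : ∀ {I J : Set} (xs : List I) (ys : List J) →
    Enumeration xs → Enumeration ys → Enumeration (cartesianProduct xs ys)
  cartesianProduct-enumeration xs ys enumˣ enumʸ (x , y) h h≡0 = begin
    ∑ (cartesianProduct xs ys) h
      ≡⟨ ∑-cartesianProduct xs ys h ⟩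
    ∑ xs (λ i → ∑ ys λ j → h (i , j))
      ≡⟨ (∑-cong xs λ i → enumʸ y _ λ j j≢y → h≡0 (i , j) λ { refl → j≢y refl }) ⟩
    ∑ xs (λ i → h (i , y))
      ≡⟨ enumˣ x _ (λ i i≢x → h≡0 (i , y) λ { refl → i≢x refl }) ⟩
    h (x , y) ∎
    where open ≡-Reasoning

  -- Write `h (σ x)` as the sum over `y` of `h y` weighted by the indicator of `σ x ≡ y`, then
  -- exchange the sums: for fixed `y` only `x = τ y` contributes. No permutation of the list itself
  -- is involved.
  ∑-reindex : ∀ {I : Set} (_≟ᴵ_ : DecidableEquality I) (xs : List I) → Enumeration xs →
    (σ τ : I → I) → (∀ x → τ (σ x) ≡ x) → (∀ y → σ (τ y) ≡ y) →
    (h : I → ℤ) → ∑ xs (h ∘ σ) ≡ ∑ xs h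
  ∑-reindex _≟ᴵ_ xs enum σ τ τσ στ h = begin
    ∑ xs (λ x → h (σ x))
      ≡⟨ (∑-cong xs λ x → trans
           (enum (σ x) (δ x) λ y y≢σx →
             trans (cong (_* h y) (𝟏-false (σ x ≟ᴵ y) (y≢σx ∘ sym))) (ℤ.*-zeroˡ (h y)))
           (hit x (σ x) refl)) ⟨
    ∑ xs (λ x → ∑ xs (δ x))
      ≡⟨ ∑-comm xs xs δ ⟩
    ∑ xs (λ y → ∑ xs λ x → δ x y)
      ≡⟨ (∑-cong xs λ y → trans
           (enum (τ y) (λ x → δ x y) λ x x≢τy →
             trans (cong (_* h y) (𝟏-false (σ x ≟ᴵ y) λ { refl → x≢τy (sym (τσ x)) }))
                   (ℤ.*-zeroˡ (h y)))
           (hit (τ y) y (στ y))) ⟩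
    ∑ xs h ∎
    where
    open ≡-Reasoning
    δ = λ x y → 𝟏 (σ x ≟ᴵ y) * h y
    hit : ∀ x y → σ x ≡ y → δ x y ≡ h y
    hit x y eq = trans (cong (_* h y) (𝟏-true (σ x ≟ᴵ y) eq)) (ℤ.*-identityˡ (h y))

  ∑-subset : ∀ {n} (A : Subset n) → ∑ (allFin n) (λ i → ⟦ lookup A i ⟧) ≡ + ∣ A ∣
  ∑-subset []      = refl
  ∑-subset {ℕ.suc n} (x ∷ A) = trans
    (+-congˡ ⟦ x ⟧ (trans (∑-tabulate-∘ {n} suc (λ i → ⟦ lookup (x ∷ A) i ⟧)) (∑-subset A)))
    (step x)
    where
    step : ∀ x → ⟦ x ⟧ + + ∣ A ∣ ≡ + ∣ x ∷ A ∣
    step true  = refl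
    step false = refl

-- Elementary algebra of a quasifield.

module QuasifieldProperties {q : ℕ} (Q : Quasifield q) where
  open Quasifield Q
  open import Data.Integer using (_*_)

  additiveGroup : Group _ _
  additiveGroup = record
    { isGroup = record
      { isMonoid = record
        { isSemigroup = record
          { isMagma = record { isEquivalence = isEquivalence ; ∙-cong = cong₂ _⊕_ }
          ; assoc   = ⊕-assoc
          }
        ; identity = ⊕-identityˡ , ⊕-identityʳ
        }
      ; inverse = ⊕-inverseˡ , ⊕-inverseʳ
      ; ⁻¹-cong = cong ⊖_
      }
    }

  open GroupProperties additiveGroup

  -- Left distributivity makes `a ⊙ 𝟘` additively idempotent, and the only idempotent of a group is
  -- its identity.
  zeroʳ : ∀ a → a ⊙ 𝟘 ≡ 𝟘
  zeroʳ a = identityˡ-unique (a ⊙ 𝟘) (a ⊙ 𝟘)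
    (trans (sym (distribˡ a 𝟘 𝟘)) (cong (a ⊙_) (⊕-identityˡ 𝟘)))

  ⊙-⊖ : ∀ a x → a ⊙ (⊖ x) ≡ ⊖ (a ⊙ x)
  ⊙-⊖ a x = inverseˡ-unique _ _
    (trans (sym (distribˡ a (⊖ x) x)) (trans (cong (a ⊙_) (⊕-inverseˡ x)) (zeroʳ a)))

  -- The loop axioms concern nonzero elements only. This lemma and the next three extend
  -- cancellation and division to all of `Q`, so that multiplication by a nonzero element on either
  -- side is a permutation that `∑-reindex` can use.
  ⊙-injectiveʳ : ∀ {k} → k ≢ 𝟘 → ∀ {x y} → x ⊙ k ≡ y ⊙ k → x ≡ y
  ⊙-injectiveʳ {k} k≢𝟘 {x} {y} eq with x ≟ 𝟘 | y ≟ 𝟘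
  ... | yes refl | yes refl = refl
  ... | yes refl | no y≢𝟘   = ⊥-elim (⊙-closed y k y≢𝟘 k≢𝟘 (trans (sym eq) (zeroˡ k)))
  ... | no x≢𝟘   | yes refl = ⊥-elim (⊙-closed x k x≢𝟘 k≢𝟘 (trans eq (zeroˡ k)))
  ... | no x≢𝟘   | no y≢𝟘   = right-div-unique k x y k≢𝟘 x≢𝟘 y≢𝟘 eq

  ⊙-injectiveˡ : ∀ {a} → a ≢ 𝟘 → ∀ {x y} → a ⊙ x ≡ a ⊙ y → x ≡ y
  ⊙-injectiveˡ {a} a≢𝟘 {x} {y} eq with x ≟ 𝟘 | y ≟ 𝟘
  ... | yes refl | yes refl = refl
  ... | yes refl | no y≢𝟘   = ⊥-elim (⊙-closed a y a≢𝟘 y≢𝟘 (trans (sym eq) (zeroʳ a)))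
  ... | no x≢𝟘   | yes refl = ⊥-elim (⊙-closed a x a≢𝟘 x≢𝟘 (trans eq (zeroʳ a)))
  ... | no x≢𝟘   | no y≢𝟘   = left-div-unique a x y a≢𝟘 x≢𝟘 y≢𝟘 eq

  ⊙-surjectiveʳ : ∀ {k} → k ≢ 𝟘 → ∀ b → Σ (Fin q) λ x → x ⊙ k ≡ b
  ⊙-surjectiveʳ {k} k≢𝟘 b with b ≟ 𝟘
  ... | yes refl = 𝟘 , zeroˡ k
  ... | no b≢𝟘   = let x , _ , eq = right-div k b k≢𝟘 b≢𝟘 in x , eq

  ⊙-surjectiveˡ : ∀ {a} → a ≢ 𝟘 → ∀ b → Σ (Fin q) λ x → a ⊙ x ≡ b
  ⊙-surjectiveˡ {a} a≢𝟘 b with b ≟ 𝟘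
  ... | yes refl = 𝟘 , zeroʳ a
  ... | no b≢𝟘   = let x , _ , eq = left-div a b a≢𝟘 b≢𝟘 in x , eq

  -- Guarantees that `∣ K ∣ ∸ 1` is a genuine subtraction, counting the nonzero kernel elements.
  𝟘∈kernel : InKernel 𝟘
  𝟘∈kernel =
      (λ x y → trans (zeroʳ _) (sym (trans (cong₂ _⊕_ (zeroʳ x) (zeroʳ y)) (⊕-identityˡ 𝟘))))
    , (λ x y → trans (zeroʳ _) (sym (trans (cong (x ⊙_) (zeroʳ y)) (zeroʳ x))))

  -- The form on pairs and its planar equations.

  Pair : Set
  Pair = Fin q × Fin q

  infix 8 _·_ _▹_

  _·_ : Pair → Pair → Fin q
  (a , c) · (b , d) = (a ⊙ b) ⊕ (c ⊙ d)

  _▹_ : Pair → Fin q → Pair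
  (b , d) ▹ k = (b ⊙ k) , (d ⊙ k)

  -- Both kernel conditions enter here: distributivity splits the sum and associativity moves `k`
  -- inside each product.
  ·-▹ : ∀ {k} → InKernel k → ∀ x y → x · (y ▹ k) ≡ (x · y) ⊙ k
  ·-▹ {k} (distrib , assoc) (a , c) (b , d) =
    sym (trans (distrib (a ⊙ b) (c ⊙ d)) (cong₂ _⊕_ (assoc a b) (assoc c d)))

  solveˡ : ∀ {a a′} c c′ d → a ≢ a′ → Σ (Fin q) λ b →
    (a , c) · (b , d) ≡ (a′ , c′) · (b , d) ×
    (∀ y → (a , c) · (y , d) ≡ (a′ , c′) · (y , d) → y ≡ b)
  solveˡ {a} {a′} c c′ d a≢a′ =
    let b , eq = planar a a′ e a≢a′ in
    b , from eq , λ y eq′ → planar-unique a a′ e y b a≢a′ (to eq′) eq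
    where
    -- Cancelling `c ⊙ d` on the right needs no commutativity, and brings the equation into the
    -- shape of `planar` with constant term `e`.
    e = (c′ ⊙ d) ⊕ (⊖ (c ⊙ d))
    to : ∀ {y} → (a ⊙ y) ⊕ (c ⊙ d) ≡ (a′ ⊙ y) ⊕ (c′ ⊙ d) → a ⊙ y ≡ (a′ ⊙ y) ⊕ e
    to eq = trans (x≈z//y _ _ _ eq) (⊕-assoc _ _ _)
    from : ∀ {y} → a ⊙ y ≡ (a′ ⊙ y) ⊕ e → (a ⊙ y) ⊕ (c ⊙ d) ≡ (a′ ⊙ y) ⊕ (c′ ⊙ d)
    from eq = trans (cong (_⊕ (c ⊙ d)) (trans eq (sym (⊕-assoc _ _ _)))) (//-rightDividesˡ _ _)

  ⊖-· : ∀ a b c d → ⊖ ((a , c) · (b , d)) ≡ (c , a) · (⊖ d , ⊖ b)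
  ⊖-· a b c d = trans (⁻¹-anti-homo-∙ _ _) (sym (cong₂ _⊕_ (⊙-⊖ c d) (⊙-⊖ a b)))

  -- ⊕ is not assumed commutative, but negation reverses the order of the summands.
  solveʳ : ∀ a a′ {c c′} b → c ≢ c′ → Σ (Fin q) λ d →
    (a , c) · (b , d) ≡ (a′ , c′) · (b , d) ×
    (∀ y → (a , c) · (b , y) ≡ (a′ , c′) · (b , y) → y ≡ d)
  -- After negation `c` and `c′` come first, so `solveˡ` applies; its unknown is the negative of the
  -- one sought.
  solveʳ a a′ {c} {c′} b c≢c′ with solveˡ a a′ (⊖ b) c≢c′
  ... | d , eq , unique = ⊖ d , from eq , λ y eq′ →
    trans (sym (⁻¹-involutive y)) (cong ⊖_ (unique (⊖ y)
      (trans (sym (⊖-· a b c y)) (trans (cong ⊖_ eq′) (⊖-· a′ b c′ y)))))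
    where
    from : (c , a) · (d , ⊖ b) ≡ (c′ , a′) · (d , ⊖ b) →
           (a , c) · (b , ⊖ d) ≡ (a′ , c′) · (b , ⊖ d)
    from eq = subst (λ z → (a , c) · (z , ⊖ d) ≡ (a′ , c′) · (z , ⊖ d)) (⁻¹-involutive b)
      (trans (sym (⊖-· c d a (⊖ b))) (trans (cong ⊖_ eq) (⊖-· c′ d a′ (⊖ b))))

  -- Counting the agreements of two pairs.

  elements : List (Fin q)
  elements = allFin q

  pairs : List Pair
  pairs = cartesianProduct elements elements

  pairs-enumeration : Enumeration pairs
  pairs-enumeration =
    cartesianProduct-enumeration elements elements (allFin-enumeration q) (allFin-enumeration q)

  ∑-pairs-const : ∀ k → ∑ pairs (λ _ → k) ≡ + q * (+ q * k)
  ∑-pairs-const k = trans (∑-cartesianProduct elements elements _)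
    (trans (∑-cong elements λ _ → ∑-const q k) (∑-const q (+ q * k)))

  ∑-𝟏-unique : ∀ {P : Fin q → Set} (P? : ∀ y → Dec (P y)) →
               (Σ (Fin q) λ x → P x × (∀ y → P y → y ≡ x)) → ∑ elements (λ y → 𝟏 (P? y)) ≡ 1ℤ
  ∑-𝟏-unique P? (x , px , unique) = trans
    (allFin-enumeration q x _ λ y y≢x → 𝟏-false (P? y) (y≢x ∘ unique y))
    (𝟏-true (P? x) px)

  agreements : Pair → Pair → ℤ
  agreements x x′ = ∑ pairs λ y → 𝟏 (x · y ≟ x′ · y)

  agreements-≡ : ∀ x → agreements x x ≡ + q * + q
  agreements-≡ x = trans (∑-cong pairs λ y → 𝟏-true (x · y ≟ x · y) refl)
    (trans (∑-pairs-const 1ℤ) (*-congˡ (+ q) (ℤ.*-identityʳ (+ q))))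

  -- Distinct pairs differ in some coordinate. For each of the `q` values of the other coordinate of
  -- `y`, planarity leaves exactly one solution.
  agreements-≢ : ∀ x x′ → x ≢ x′ → agreements x x′ ≡ + q
  agreements-≢ (a , c) (a′ , c′) x≢x′ with a ≟ a′ | c ≟ c′
  ... | yes refl | yes refl = ⊥-elim (x≢x′ refl)
  ... | no a≢a′  | _        = begin
    agreements (a , c) (a′ , c′)
      ≡⟨ ∑-cartesianProduct elements elements _ ⟩
    ∑ elements (λ b → ∑ elements λ d → 𝟏 ((a , c) · (b , d) ≟ (a′ , c′) · (b , d)))
      -- `solveˡ` finds `b` for given `d`, so the sum over `b` must be innermost.
      ≡⟨ ∑-comm elements elements _ ⟩
    ∑ elements (λ d → ∑ elements λ b → 𝟏 ((a , c) · (b , d) ≟ (a′ , c′) · (b , d)))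
      ≡⟨ (∑-cong elements λ d → ∑-𝟏-unique _ (solveˡ c c′ d a≢a′)) ⟩
    ∑ elements (λ _ → 1ℤ)
      ≡⟨ ∑-one q ⟩
    + q ∎
    where open ≡-Reasoning
  ... | yes _    | no c≢c′  = begin
    agreements (a , c) (a′ , c′)
      ≡⟨ ∑-cartesianProduct elements elements _ ⟩
    ∑ elements (λ b → ∑ elements λ d → 𝟏 ((a , c) · (b , d) ≟ (a′ , c′) · (b , d)))
      ≡⟨ (∑-cong elements λ b → ∑-𝟏-unique _ (solveʳ a a′ b c≢c′)) ⟩
    ∑ elements (λ _ → 1ℤ)
      ≡⟨ ∑-one q ⟩
    + q ∎
    where open ≡-Reasoning

  -- Orthogonality of the centred incidences.

  -- The centred incidence: q times the indicator of x · y = g, minus its mean.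
  φ : Pair → Pair × Fin q → ℤ
  φ x (y , g) = + q * 𝟏 (x · y ≟ g) - 1ℤ

  ∑-𝟏 : ∀ v → ∑ elements (λ g → 𝟏 (v ≟ g)) ≡ 1ℤ
  ∑-𝟏 v = ∑-𝟏-unique (v ≟_) (v , refl , λ _ → sym)

  ∑-𝟏*𝟏 : ∀ v v′ → ∑ elements (λ g → 𝟏 (v ≟ g) * 𝟏 (v′ ≟ g)) ≡ 𝟏 (v ≟ v′)
  ∑-𝟏*𝟏 v v′ = trans
    (allFin-enumeration q v _ λ g g≢v →
      trans (cong (_* 𝟏 (v′ ≟ g)) (𝟏-false (v ≟ g) (g≢v ∘ sym))) (ℤ.*-zeroˡ (𝟏 (v′ ≟ g))))
    (trans (cong (_* 𝟏 (v′ ≟ v)) (𝟏-true (v ≟ v) refl))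
      (trans (ℤ.*-identityˡ _) (𝟏-cong (v′ ≟ v) (v ≟ v′) sym sym)))

  -- The quadratic term survives only where the two values agree. The two linear terms give `- q`
  -- each and the constant term gives `+ q`, leaving `- q`.
  ∑-φ*φ : ∀ x x′ y → ∑ elements (λ g → φ x (y , g) * φ x′ (y , g)) ≡
                     + q * + q * 𝟏 (x · y ≟ x′ · y) - + q
  ∑-φ*φ x x′ y = begin
    ∑ elements (λ g → φ x (y , g) * φ x′ (y , g))
      ≡⟨ (∑-cong elements λ g → expand (+ q) (s g) (t g)) ⟩
    ∑ elements (λ g → (+ q * + q * (s g * t g) - + q * (s g + t g)) + 1ℤ)
      ≡⟨ ∑-+ elements _ _ ⟩
    ∑ elements (λ g → + q * + q * (s g * t g) - + q * (s g + t g)) + ∑ elements (λ _ → 1ℤ)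
      ≡⟨ cong₂ _+_
           (trans (∑-- elements _ _) (cong₂ _-_
             (trans (∑-*ˡ elements (+ q * + q) _) (*-congˡ (+ q * + q) (∑-𝟏*𝟏 (x · y) (x′ · y))))
             (trans (∑-*ˡ elements (+ q) _) (*-congˡ (+ q)
               (trans (∑-+ elements s t) (cong₂ _+_ (∑-𝟏 (x · y)) (∑-𝟏 (x′ · y))))))))
           (∑-one q) ⟩
    (+ q * + q * 𝟏 (x · y ≟ x′ · y) - + q * + 2) + + q
      ≡⟨ collect (+ q) (𝟏 (x · y ≟ x′ · y)) ⟩
    + q * + q * 𝟏 (x · y ≟ x′ · y) - + q ∎
    where
    open ≡-Reasoning
    s = λ g → 𝟏 (x · y ≟ g)
    t = λ g → 𝟏 (x′ · y ≟ g)
    expand : ∀ n s t → (n * s - 1ℤ) * (n * t - 1ℤ) ≡ (n * n * (s * t) - n * (s + t)) + 1ℤ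
    expand = solve-∀
    collect : ∀ n e → (n * n * e - n * + 2) + n ≡ n * n * e - n
    collect = solve-∀

  incidences : List (Pair × Fin q)
  incidences = cartesianProduct pairs elements

  -- The inner product depends on the agreement count alone, and it vanishes exactly at the count
  -- `q` of distinct pairs when `q` is positive.
  ⟨φ,φ⟩ : ∀ x x′ → ∑ incidences (λ v → φ x v * φ x′ v) ≡
                   + q * + q * agreements x x′ - + q * (+ q * + q)
  ⟨φ,φ⟩ x x′ = begin
    ∑ incidences (λ v → φ x v * φ x′ v)
      ≡⟨ ∑-cartesianProduct pairs elements _ ⟩
    ∑ pairs (λ y → ∑ elements λ g → φ x (y , g) * φ x′ (y , g))
      ≡⟨ ∑-cong pairs (∑-φ*φ x x′) ⟩
    ∑ pairs (λ y → + q * + q * 𝟏 (x · y ≟ x′ · y) - + q)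
      ≡⟨ trans (∑-- pairs _ _) (cong₂ _-_ (∑-*ˡ pairs (+ q * + q) _) (∑-pairs-const (+ q))) ⟩
    + q * + q * agreements x x′ - + q * (+ q * + q) ∎
    where open ≡-Reasoning

  φ-orthogonal : ∀ x x′ → x ≢ x′ → ∑ incidences (λ v → φ x v * φ x′ v) ≡ 0ℤ
  φ-orthogonal x x′ x≢x′ = trans (⟨φ,φ⟩ x x′)
    (trans (cong (λ e → + q * + q * e - + q * (+ q * + q)) (agreements-≢ x x′ x≢x′))
           (vanish (+ q)))
    where
    vanish : ∀ n → n * n * n - n * (n * n) ≡ 0ℤ
    vanish = solve-∀

  -- The exact value is `q ^ 4` minus `q ^ 3`; the cube is dropped.
  ‖φ‖² : ∀ x → ∑ incidences (λ v → φ x v * φ x v) ≤ + (q ℕ.^ 4)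
  ‖φ‖² x = begin
    ∑ incidences (λ v → φ x v * φ x v)
      ≡⟨ trans (⟨φ,φ⟩ x x)
           (cong (λ e → + q * + q * e - + q * (+ q * + q)) (agreements-≡ x)) ⟩
    + q * + q * (+ q * + q) - + q * (+ q * + q)
      -- As the cast of a natural number, the subtracted cube is visibly nonnegative.
      ≡⟨ cong (λ e → + q * + q * (+ q * + q) - e) cube ⟨
    + q * + q * (+ q * + q) - + (q ℕ.* (q ℕ.* q))
      ≤⟨ ℤ.i-j≤i _ (+ (q ℕ.* (q ℕ.* q))) ⟩
    + q * + q * (+ q * + q)
      ≡⟨ cong₂ _*_ (ℤ.pos-* q q) (ℤ.pos-* q q) ⟨
    + (q ℕ.* q) * + (q ℕ.* q)
      ≡⟨ ℤ.pos-* (q ℕ.* q) (q ℕ.* q) ⟨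
    + (q ℕ.* q ℕ.* (q ℕ.* q))
      ≡⟨ cong +_ (trans (ℕ.*-assoc q q (q ℕ.* q))
           (cong (λ e → q ℕ.* (q ℕ.* (q ℕ.* e))) (sym (ℕ.*-identityʳ q)))) ⟩
    + (q ℕ.^ 4) ∎
    where
    open ℤ.≤-Reasoning
    cube : + (q ℕ.* (q ℕ.* q)) ≡ + q * (+ q * + q)
    cube = trans (ℤ.pos-* q (q ℕ.* q)) (*-congˡ (+ q) (ℤ.pos-* q q))

  -- Second moment and kernel invariance.

  module Discrepancy (w : Pair → ℤ) where

    -- At `(y , g)` this is `q` times the weight of the line of all `x` with `x · y ≡ g`, minus the
    -- total weight.
    T : Pair × Fin q → ℤ
    T v = ∑ pairs λ x → w x * φ x v

    S : Fin q → ℤ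
    S g = ∑ pairs λ y → T (y , g) * T (y , g)

    0≤S : ∀ g → 0ℤ ≤ S g
    0≤S g = ∑-nonneg pairs λ y → 0≤i*i (T (y , g))

    -- Orthogonality leaves only the diagonal of the Gram matrix. Idempotence then turns the squared
    -- weights into weights, so the bound is linear in the total weight.
    secondMoment : (∀ x → w x * w x ≡ w x) → (∀ x → 0ℤ ≤ w x) →
                   ∑ elements S ≤ + (q ℕ.^ 4) * ∑ pairs w
    secondMoment w-idem 0≤w = begin
      ∑ elements S
        ≡⟨ ∑-comm elements pairs _ ⟩
      ∑ pairs (λ y → ∑ elements λ g → T (y , g) * T (y , g))
        ≡⟨ ∑-cartesianProduct pairs elements _ ⟨
      ∑ incidences (λ v → T v * T v)
        ≡⟨ ∑-square pairs incidences w φ ⟩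
      ∑ pairs (λ x → w x * ∑ pairs (λ x′ → w x′ * G x x′))
        ≡⟨ (∑-cong pairs λ x → *-congˡ (w x) (pairs-enumeration x _ λ x′ x′≢x →
             trans (*-congˡ (w x′) (φ-orthogonal x x′ (x′≢x ∘ sym))) (ℤ.*-zeroʳ (w x′)))) ⟩
      ∑ pairs (λ x → w x * (w x * G x x))
        ≡⟨ (∑-cong pairs λ x → trans (sym (ℤ.*-assoc (w x) (w x) (G x x)))
             (trans (cong (_* G x x) (w-idem x)) (ℤ.*-comm (w x) (G x x)))) ⟩
      ∑ pairs (λ x → G x x * w x)
        ≤⟨ (∑-mono pairs λ x →
             ℤ.*-monoʳ-≤-nonNeg (w x) ⦃ nonNegative (0≤w x) ⦄ (‖φ‖² x)) ⟩
      ∑ pairs (λ x → + (q ℕ.^ 4) * w x)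
        ≡⟨ ∑-*ˡ pairs (+ (q ℕ.^ 4)) w ⟩
      + (q ℕ.^ 4) * ∑ pairs w ∎
      where
      open ℤ.≤-Reasoning
      G = λ x x′ → ∑ incidences λ v → φ x v * φ x′ v

    -- Since `k` can be cancelled on the right, `x · (y ▹ k) ≡ g ⊙ k` and `x · y ≡ g` are equivalent
    -- for every `x`; the sums agree term by term.
    T-▹ : ∀ {k} → InKernel k → k ≢ 𝟘 → ∀ y g → T (y ▹ k , g ⊙ k) ≡ T (y , g)
    T-▹ {k} k∈ker k≢𝟘 y g = ∑-cong pairs λ x → *-congˡ (w x)
      (cong (λ e → + q * e - 1ℤ) (𝟏-cong (x · (y ▹ k) ≟ g ⊙ k) (x · y ≟ g)
        (λ eq → ⊙-injectiveʳ k≢𝟘 (trans (sym (·-▹ k∈ker x y)) eq))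
        (λ eq → trans (·-▹ k∈ker x y) (cong (_⊙ k) eq))))

    S-⊙ : ∀ {k} → InKernel k → k ≢ 𝟘 → ∀ g → S (g ⊙ k) ≡ S g
    S-⊙ {k} k∈ker k≢𝟘 g = begin
      S (g ⊙ k)
        -- Scaling by a nonzero `k` permutes the pairs, with coordinatewise right division as its
        -- inverse.
        ≡⟨ ∑-reindex (≡-dec _≟_ _≟_) pairs pairs-enumeration (_▹ k) τ
             (λ (b , d) → cong₂ _,_ (⊙-injectiveʳ k≢𝟘 (section (b ⊙ k)))
                                    (⊙-injectiveʳ k≢𝟘 (section (d ⊙ k))))
             (λ (b , d) → cong₂ _,_ (section b) (section d)) _ ⟨
      ∑ pairs (λ y → T (y ▹ k , g ⊙ k) * T (y ▹ k , g ⊙ k))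
        ≡⟨ (∑-cong pairs λ y → cong₂ _*_ (T-▹ k∈ker k≢𝟘 y g) (T-▹ k∈ker k≢𝟘 y g)) ⟩
      S g ∎
      where
      open ≡-Reasoning
      _/k : Fin q → Fin q
      b /k = proj₁ (⊙-surjectiveʳ k≢𝟘 b)
      section : ∀ b → (b /k) ⊙ k ≡ b
      section b = proj₂ (⊙-surjectiveʳ k≢𝟘 b)
      τ : Pair → Pair
      τ (b , d) = b /k , d /k

    -- The values γ ⊙ k, for k a nonzero kernel element, are distinct and S agrees on them.
    kernel-S : (K : Subset q) → (∀ k → (k ∈ K) ⇔ InKernel k) → ∀ {γ} → γ ≢ 𝟘 →
               + (∣ K ∣ ℕ.∸ 1) * S γ ≤ ∑ elements S
    kernel-S K K⇔ {γ} γ≢𝟘 = begin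
      + (∣ K ∣ ℕ.∸ 1) * S γ
        ≡⟨ cong (_* S γ) (trans (∑-- elements _ _)
             (trans (cong₂ _-_ (∑-subset K) (∑-𝟏 𝟘))
                    (trans (ℤ.m-n≡m⊖n ∣ K ∣ 1) (ℤ.⊖-≥ 1≤∣K∣)))) ⟨
      ∑ elements κ * S γ
        ≡⟨ ∑-*ʳ elements (S γ) κ ⟨
      ∑ elements (λ k → κ k * S γ)
        -- Where `κ` vanishes, the term on the right is a sum of squares and can be added freely.
        ≤⟨ ∑-mono elements bound ⟩
      ∑ elements (λ k → S (γ ⊙ k))
        ≡⟨ ∑-reindex _≟_ elements (allFin-enumeration q) (γ ⊙_)
             (λ b → proj₁ (⊙-surjectiveˡ γ≢𝟘 b))
             (λ x → ⊙-injectiveˡ γ≢𝟘 (proj₂ (⊙-surjectiveˡ γ≢𝟘 (γ ⊙ x))))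
             (λ b → proj₂ (⊙-surjectiveˡ γ≢𝟘 b)) S ⟩
      ∑ elements S ∎
      where
      open ℤ.≤-Reasoning
      𝟘∈K : 𝟘 ∈ K
      𝟘∈K = Equivalence.from (K⇔ 𝟘) 𝟘∈kernel
      1≤∣K∣ : 1 ℕ.≤ ∣ K ∣
      1≤∣K∣ = ℕ.≤-trans (s≤s z≤n) (x∈p⇒∣p-x∣<∣p∣ 𝟘∈K)
      κ : Fin q → ℤ
      -- The indicator of the nonzero part of `K`, written as a difference so that its sum splits.
      κ k = ⟦ lookup K k ⟧ - 𝟏 (𝟘 ≟ k)
      bound : ∀ k → κ k * S γ ≤ S (γ ⊙ k)
      bound k with 𝟘 ≟ k
      -- At `𝟘` both indicators equal one, so `κ` is zero there.
      ... | yes refl rewrite []=⇒lookup 𝟘∈K = 0≤S (γ ⊙ 𝟘)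
      ... | no 𝟘≢k with lookup K k in k∈K
      ...   | false = 0≤S (γ ⊙ k)
      ...   | true  = ℤ.≤-reflexive (trans (ℤ.*-identityˡ (S γ))
              (sym (S-⊙ (Equivalence.to (K⇔ k) (lookup⇒[]= k K k∈K)) (𝟘≢k ∘ sym) γ)))

  -- Recovering the solution count.

  0≤⟦⟧ : ∀ b → 0ℤ ≤ ⟦ b ⟧
  0≤⟦⟧ true  = +≤+ z≤n
  0≤⟦⟧ false = +≤+ z≤n

  _⊠_ : Subset q → Subset q → Pair → ℤ
  (A ⊠ C) (a , c) = ⟦ lookup A a ∧ lookup C c ⟧

  ∑-⊠ : ∀ A C → ∑ pairs (A ⊠ C) ≡ + ∣ A ∣ * + ∣ C ∣
  ∑-⊠ A C = begin
    ∑ pairs (A ⊠ C)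
      ≡⟨ ∑-cartesianProduct elements elements _ ⟩
    ∑ elements (λ a → ∑ elements λ c → ⟦ lookup A a ∧ lookup C c ⟧)
      ≡⟨ (∑-cong elements λ a → ∑-cong elements λ c → ⟦⟧-∧ (lookup A a) (lookup C c)) ⟩
    ∑ elements (λ a → ∑ elements λ c → ⟦ lookup A a ⟧ * ⟦ lookup C c ⟧)
      ≡⟨ ∑*∑ elements elements _ _ ⟩
    ∑ elements (λ a → ⟦ lookup A a ⟧) * ∑ elements (λ c → ⟦ lookup C c ⟧)
      ≡⟨ cong₂ _*_ (∑-subset A) (∑-subset C) ⟩
    + ∣ A ∣ * + ∣ C ∣ ∎
    where open ≡-Reasoning

  ∑-⊠*∑-⊠ : ∀ A B C D → ∑ pairs (B ⊠ D) * ∑ pairs (A ⊠ C) ≡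
                        + (∣ A ∣ ℕ.* ∣ B ∣ ℕ.* ∣ C ∣ ℕ.* ∣ D ∣)
  ∑-⊠*∑-⊠ A B C D = begin
    ∑ pairs (B ⊠ D) * ∑ pairs (A ⊠ C)
      ≡⟨ cong₂ _*_ (∑-⊠ B D) (∑-⊠ A C) ⟩
    + ∣ B ∣ * + ∣ D ∣ * (+ ∣ A ∣ * + ∣ C ∣)
      ≡⟨ shuffle (+ ∣ A ∣) (+ ∣ B ∣) (+ ∣ C ∣) (+ ∣ D ∣) ⟩
    + ∣ A ∣ * + ∣ B ∣ * + ∣ C ∣ * + ∣ D ∣
      ≡⟨ cong (λ e → e * + ∣ C ∣ * + ∣ D ∣) (ℤ.pos-* ∣ A ∣ ∣ B ∣) ⟨
    + (∣ A ∣ ℕ.* ∣ B ∣) * + ∣ C ∣ * + ∣ D ∣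
      ≡⟨ cong (_* + ∣ D ∣) (ℤ.pos-* (∣ A ∣ ℕ.* ∣ B ∣) ∣ C ∣) ⟨
    + (∣ A ∣ ℕ.* ∣ B ∣ ℕ.* ∣ C ∣) * + ∣ D ∣
      ≡⟨ ℤ.pos-* (∣ A ∣ ℕ.* ∣ B ∣ ℕ.* ∣ C ∣) ∣ D ∣ ⟨
    + (∣ A ∣ ℕ.* ∣ B ∣ ℕ.* ∣ C ∣ ℕ.* ∣ D ∣) ∎
    where
    open ≡-Reasoning
    shuffle : ∀ a b c d → b * d * (a * c) ≡ a * b * c * d
    shuffle = solve-∀

  sumFin-∑ : (f : Fin q → ℕ) {g : Fin q → ℤ} → (∀ i → + f i ≡ g i) → + sumFin f ≡ ∑ elements g
  sumFin-∑ f f≗g = trans (sym (∑-tabulate id f)) (∑-cong elements f≗g)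

  module _ (γ : Fin q) (A B C D : Subset q) where

    -- The count runs over `a`, `b`, `c`, `d` in turn. Exchanging the middle two sums groups the
    -- variables as `x = (a , c)` and `y = (b , d)`.
    Nγ-∑ : + Nγ Q γ A B C D ≡
           ∑ pairs (λ y → ∑ pairs λ x → (B ⊠ D) y * ((A ⊠ C) x * 𝟏 (x · y ≟ γ)))
    Nγ-∑ = begin
      + Nγ Q γ A B C D
        ≡⟨ (sumFin-∑ _ λ a → sumFin-∑ _ λ b → sumFin-∑ _ λ c → sumFin-∑ _ λ d →
             indicator (lookup A a) (lookup B b) (lookup C c) (lookup D d)
                       ⌊ (a , c) · (b , d) ≟ γ ⌋) ⟩
      ∑ elements (λ a → ∑ elements λ b → ∑ elements λ c → ∑ elements λ d → F (a , c) (b , d))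
        ≡⟨ (∑-cong elements λ a → ∑-comm elements elements _) ⟩
      ∑ elements (λ a → ∑ elements λ c → ∑ elements λ b → ∑ elements λ d → F (a , c) (b , d))
        ≡⟨ (∑-cong elements λ a → ∑-cong elements λ c →
             ∑-cartesianProduct elements elements (F (a , c))) ⟨
      ∑ elements (λ a → ∑ elements λ c → ∑ pairs (F (a , c)))
        ≡⟨ ∑-cartesianProduct elements elements (λ x → ∑ pairs (F x)) ⟨
      ∑ pairs (λ x → ∑ pairs (F x))
        ≡⟨ ∑-comm pairs pairs F ⟩
      ∑ pairs (λ y → ∑ pairs λ x → F x y) ∎
      where
      open ≡-Reasoning
      F : Pair → Pair → ℤ
      F x y = (B ⊠ D) y * ((A ⊠ C) x * 𝟏 (x · y ≟ γ))
      indicator : ∀ a b c d e →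
        + (if a ∧ b ∧ c ∧ d ∧ e then 1 else 0) ≡ ⟦ b ∧ d ⟧ * (⟦ a ∧ c ⟧ * ⟦ e ⟧)
      indicator false b     c     d     e     = sym (ℤ.*-zeroʳ ⟦ b ∧ d ⟧)
      indicator true  false c     d     e     = refl
      indicator true  true  false d     e     = sym (ℤ.*-zeroʳ ⟦ d ⟧)
      indicator true  true  true  false e     = refl
      indicator true  true  true  true  false = refl
      indicator true  true  true  true  true  = refl

    open Discrepancy (A ⊠ C)

    -- The two terms of `φ` separate: the scaled indicator sums to `q` times the count, and the
    -- constant sums to the product of the four sizes.
    discrepancy : + (q ℕ.* Nγ Q γ A B C D) - + (∣ A ∣ ℕ.* ∣ B ∣ ℕ.* ∣ C ∣ ℕ.* ∣ D ∣) ≡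
                  ∑ pairs (λ y → (B ⊠ D) y * T (y , γ))
    discrepancy = sym (begin
      ∑ pairs (λ y → (B ⊠ D) y * T (y , γ))
        ≡⟨ (∑-cong pairs λ y → trans (sym (∑-*ˡ pairs ((B ⊠ D) y) _))
             (∑-cong pairs λ x → expand (+ q) ((B ⊠ D) y) ((A ⊠ C) x) (𝟏 (x · y ≟ γ)))) ⟩
      ∑ pairs (λ y → ∑ pairs λ x → + q * F x y - (B ⊠ D) y * (A ⊠ C) x)
        ≡⟨ (∑-cong pairs λ y → trans (∑-- pairs _ _)
             (cong (_- ∑ pairs (λ x → (B ⊠ D) y * (A ⊠ C) x)) (∑-*ˡ pairs (+ q) _))) ⟩
      ∑ pairs (λ y → + q * ∑ pairs (λ x → F x y) - ∑ pairs (λ x → (B ⊠ D) y * (A ⊠ C) x))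
        ≡⟨ trans (∑-- pairs _ _) (cong₂ _-_ (∑-*ˡ pairs (+ q) _) (∑*∑ pairs pairs (B ⊠ D) (A ⊠ C))) ⟩
      + q * ∑ pairs (λ y → ∑ pairs λ x → F x y) - ∑ pairs (B ⊠ D) * ∑ pairs (A ⊠ C)
        ≡⟨ cong₂ _-_ (trans (*-congˡ (+ q) (sym Nγ-∑)) (sym (ℤ.pos-* q _)))
                     (∑-⊠*∑-⊠ A B C D) ⟩
      + (q ℕ.* Nγ Q γ A B C D) - + (∣ A ∣ ℕ.* ∣ B ∣ ℕ.* ∣ C ∣ ℕ.* ∣ D ∣) ∎)
      where
      open ≡-Reasoning
      F : Pair → Pair → ℤ
      F x y = (B ⊠ D) y * ((A ⊠ C) x * 𝟏 (x · y ≟ γ))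
      expand : ∀ n b w e → b * (w * (n * e - 1ℤ)) ≡ n * (b * (w * e)) - b * w
      expand = solve-∀

    discrepancy-bound : (K : Subset q) → (∀ k → (k ∈ K) ⇔ InKernel k) → γ ≢ 𝟘 →
      let Δ = ∑ pairs (λ y → (B ⊠ D) y * T (y , γ)) in
      + (∣ K ∣ ℕ.∸ 1) * (Δ * Δ) ≤ + (q ℕ.^ 4) * (∑ pairs (B ⊠ D) * ∑ pairs (A ⊠ C))
    discrepancy-bound K K⇔ γ≢𝟘 = begin
      k * (Δ * Δ)
        ≤⟨ ℤ.*-monoˡ-≤-nonNeg k (cauchySchwarz pairs (B ⊠ D) (λ y → T (y , γ))) ⟩
      k * (∑ pairs (λ y → (B ⊠ D) y * (B ⊠ D) y) * S γ)
        -- The weight on `B ⊠ D` is an indicator, hence equal to its square.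
        ≡⟨ *-congˡ k (cong (_* S γ) (∑-cong pairs λ (b , d) → ⟦⟧-idem (lookup B b ∧ lookup D d))) ⟩
      k * (∑ pairs (B ⊠ D) * S γ)
        ≡⟨ exchange k (∑ pairs (B ⊠ D)) (S γ) ⟩
      ∑ pairs (B ⊠ D) * (k * S γ)
        -- The kernel factor now stands next to a single slice, which `kernel-S` trades for the
        -- whole second moment.
        ≤⟨ ℤ.*-monoˡ-≤-nonNeg (∑ pairs (B ⊠ D)) ⦃ nonNeg ⦄ (ℤ.≤-trans (kernel-S K K⇔ γ≢𝟘)
             (secondMoment (λ (a , c) → ⟦⟧-idem (lookup A a ∧ lookup C c))
                           (λ (a , c) → 0≤⟦⟧ (lookup A a ∧ lookup C c)))) ⟩
      ∑ pairs (B ⊠ D) * (+ (q ℕ.^ 4) * ∑ pairs (A ⊠ C))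
        ≡⟨ exchange (∑ pairs (B ⊠ D)) (+ (q ℕ.^ 4)) (∑ pairs (A ⊠ C)) ⟩
      + (q ℕ.^ 4) * (∑ pairs (B ⊠ D) * ∑ pairs (A ⊠ C)) ∎
      where
      open ℤ.≤-Reasoning
      k = + (∣ K ∣ ℕ.∸ 1)
      Δ = ∑ pairs (λ y → (B ⊠ D) y * T (y , γ))
      nonNeg : NonNegative (∑ pairs (B ⊠ D))
      nonNeg = nonNegative (∑-nonneg pairs λ (b , d) → 0≤⟦⟧ (lookup B b ∧ lookup D d))
      exchange : ∀ i j l → i * (j * l) ≡ j * (i * l)
      exchange = solve-∀

-- The inequality in integer form.

open import Data.Nat using (_*_; _∸_; _^_)

-- Squaring the real inequality and multiplying by `q ^ 2` and by `∣ K ∣ ∸ 1` removes the root and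
-- the fractions. Nothing is lost: both sides are nonnegative, and the kernel contains `𝟘` and `𝟙`,
-- so the factors are positive.
theorem1p13 : (q : ℕ) (Q : Quasifield q) (K : Subset q) →
    (∀ k → (k ∈ K) ⇔ Quasifield.InKernel Q k) →
    (γ : Fin q) → ¬ (γ ≡ Quasifield.𝟘 Q) →
    (A B C D : Subset q) →
    let X = ∣ A ∣ * ∣ B ∣ * ∣ C ∣ * ∣ D ∣
        N = Nγ Q γ A B C D
        Δ = (+ (q * N)) - (+ X)
    in (+ (∣ K ∣ ∸ 1)) Data.Integer.* (Δ Data.Integer.* Δ) ≤ + (q ^ 4 * X)
theorem1p13 q Q K K⇔ γ γ≢𝟘 A B C D = subst₂ _≤_
  (cong (λ Δ → + (∣ K ∣ ∸ 1) Data.Integer.* (Δ Data.Integer.* Δ)) (sym (discrepancy γ A B C D)))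
  (trans (*-congˡ (+ (q ^ 4)) (∑-⊠*∑-⊠ A B C D)) (sym (ℤ.pos-* (q ^ 4) _)))
  (discrepancy-bound γ A B C D K K⇔ γ≢𝟘)
  where open QuasifieldProperties Q
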